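{- $M(6,5)<30$. That is, every set $\Gamma$ of permutations of $\{1,\dots,6\}$ in which any two distinct elements $\phi,\psi$ satisfy $d_H(\phi,\psi)\ge 5$ has fewer than $30$ elements.
   Context: For permutations $\phi,\psi\in\mathrm{Sym}(n)$, the Hamming distance $d_H(\phi,\psi)$ is the number of non-fixed points of $\phi\psi^{ -1}$, equivalently the number of $x\in\{1,\dots,n\}$ with $\phi(x)\ne\psi(x)$. $M(n,d)$ denotes the maximum size of a subset $\Gamma\subseteq\mathrm{Sym}(n)$ such that $d_H(\phi,\psi)\ge d$ for all distinct $\phi,\psi\in\Gamma$. -}

module Defs where

open import Level using (0ℓ)
open import Data.Fin using (Fin)
open import Data.Fin.Properties using (_≟_)
open import Data.Fin.Permutation
  using (Permutation′; _⟨$⟩ʳ_; _≈_; _∘ₚ_; flip)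
open import Data.List using (List; length; filter; allFin)
open import Data.Nat using (ℕ; _≤_)
open import Data.Product using (∃-syntax; _×_)
open import Relation.Binary.Bundles using (Setoid)
open import Relation.Binary.PropositionalEquality using (_≡_; refl; sym; trans)
open import Relation.Nullary using (¬_; ¬?)

import Data.List.Membership.Setoid as Membership
import Data.List.Relation.Unary.Unique.Setoid as Uniqueness

-- Permutations are compared pointwise: propositional equality of Fin n ↔ Fin n
-- would also compare the proofs stored in the bijections.
Sym : ℕ → Setoid 0ℓ 0ℓ
Sym n = record
  { Carrier       = Permutation′ n
  ; _≈_           = _≈_
  ; isEquivalence = record
    { refl  = λ _ → refl
    ; sym   = λ p i → sym (p i)
    ; trans = λ p q i → trans (p i) (q i)
    }
  }

-- _∘ₚ_ composes from left to right, so flip ψ ∘ₚ φ is φψ⁻¹ (ψ⁻¹ first).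
dH : ∀ {n} → Permutation′ n → Permutation′ n → ℕ
dH {n} φ ψ = length (filter (λ x → ¬? ((flip ψ ∘ₚ φ) ⟨$⟩ʳ x ≟ x)) (allFin n))

-- A subset of Sym(n) is given by a list without repetitions, so that its
-- cardinality is the length of the list.
Unique : ∀ {n} → List (Permutation′ n) → Set
Unique {n} = Uniqueness.Unique (Sym n)

MinDistance≥ : ∀ {n} → ℕ → List (Permutation′ n) → Set
MinDistance≥ {n} d Γ = ∀ φ ψ → φ ∈ Γ → ψ ∈ Γ → ¬ (φ ≈ ψ) → d ≤ dH φ ψ
  where open Membership (Sym n) using (_∈_)

-- M[ n , d ]≡ m says that m is the maximum M(n,d).
M[_,_]≡_ : ℕ → ℕ → ℕ → Set
M[ n , d ]≡ m =
  (∃[ Γ ] Unique {n} Γ × MinDistance≥ d Γ × length Γ ≡ m) ×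
  (∀ Γ → Unique {n} Γ → MinDistance≥ d Γ → length Γ ≤ m)

{-# OPTIONS --safe #-}

-- Suppose Γ has at least 30 elements. Two distinct elements agree in at most
-- one point, so for fixed a ≢ b the map φ ↦ (φ a , φ b) is injective into the
-- 30 pairs of distinct symbols, hence onto: Γ is sharply 2-transitive. After
-- right multiplication by the inverse of an element, Γ contains the identity.
-- Writing permutations as words, Γ has for every pair y ≢ v a word beginning
-- with y v, and any two of these words agree in at most one position. A
-- backtracking search shows that such words cannot be chosen for all pairs;
-- starting from the identity word it visits fewer than a thousand nodes.

module Submission where

open import Defs
open import Data.Bool using (Bool; false; true; if_then_else_; T)
open import Data.Bool.ListAction using (all)
open import Data.Bool.Properties using (T?; T-≡)
open import Data.Empty using (⊥)
open import Data.Fin using (Fin; zero; suc; punchOut; combine)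
open import Data.Fin.Patterns using (0F; 1F)
open import Data.Fin.Permutation
  using (Permutation′; _⟨$⟩ʳ_; _∘ₚ_; flip; inverseˡ; inverseʳ)
open import Data.Fin.Properties
  using (_≟_; any?; suc-injective; punchOut-injective; combine-injective; injective⇒≤)
open import Data.List
  using (List; []; _∷_; length; filter; lookup; allFin; cartesianProduct; cartesianProductWith)
open import Data.List.Membership.Propositional using (_∈_)
open import Data.List.Membership.Propositional.Properties
  using (∈-filter⁺; ∈-allFin; ∈-cartesianProductWith⁺; ∈-lookup)
import Data.List.Membership.Setoid.Properties as Setoid
open import Data.List.Relation.Unary.All as All using (All; []; _∷_)
open import Data.List.Relation.Unary.All.Properties using (all⁺; all-filter)
open import Data.List.Relation.Unary.AllPairs using (AllPairs; []; _∷_)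
open import Data.List.Relation.Unary.Any using (here)
import Data.List.Relation.Unary.Unique.Propositional as List
import Data.List.Relation.Unary.Unique.Propositional.Properties as List
open import Data.Nat using (ℕ; zero; suc; _+_; _*_; _≤_; _<_; s≤s; z<s)
open import Data.Nat.Properties using (≤-trans; 1+n≰n; ≰⇒>)
open import Data.Product using (_×_; _,_; ∃-syntax)
open import Data.Product.Properties using (≡-dec)
open import Data.Vec using (Vec; []; _∷_; tabulate) renaming (lookup to _‼_)
open import Data.Vec.Properties using (lookup∘tabulate; tabulate-cong)
open import Data.Vec.Relation.Binary.Pointwise.Extensional using (ext; extensional⇒inductive)
open import Data.Vec.Relation.Binary.Pointwise.Inductive using (Pointwise; decidable)
open import Data.Vec.Relation.Unary.AllPairs using ([]; _∷_; allPairs?)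
import Data.Vec.Relation.Unary.Unique.Propositional as Vec
import Data.Vec.Relation.Unary.Unique.Propositional.Properties as Vec
open import Function using (_∘_)
open import Function.Bundles using (Injection; Equivalence)
open import Function.Definitions using (Injective)
open import Function.Properties.Inverse using (↔⇒↣)
open import Level using (Level)
open import Relation.Binary.Core using (Rel)
open import Relation.Binary.Definitions using (Symmetric)
open import Relation.Binary.PropositionalEquality
  using (_≡_; _≢_; refl; sym; trans; cong; cong₂; subst; ≢-sym)
open import Relation.Nullary using (¬?; Dec; yes; no; does; contradiction; _×-dec_)

private
  variable
    a ℓ : Level
    A : Set a
    k l m n N : ℕ

-- Counting in finite sets.

AllPairs-lookup : {R : Rel A ℓ} → Symmetric R → ∀ {xs} → AllPairs R xs →
                  ∀ {i j} → i ≢ j → R (lookup xs i) (lookup xs j)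
AllPairs-lookup R-sym (r ∷ rs) {zero}  {zero}  i≢j = contradiction refl i≢j
AllPairs-lookup R-sym (r ∷ rs) {zero}  {suc j} i≢j = All.lookup r (∈-lookup j)
AllPairs-lookup R-sym (r ∷ rs) {suc i} {zero}  i≢j = R-sym (All.lookup r (∈-lookup i))
AllPairs-lookup R-sym (r ∷ rs) {suc i} {suc j} i≢j = AllPairs-lookup R-sym rs (i≢j ∘ cong suc)

unique-length : {xs : List (Fin n)} → List.Unique xs → length xs ≤ n
unique-length {xs = xs} xs! = injective⇒≤ lookup-injective
  where
  lookup-injective : Injective _≡_ _≡_ (lookup xs)
  lookup-injective {i} {j} eq with i ≟ j
  ... | yes i≡j = i≡j
  ... | no  i≢j = contradiction eq (AllPairs-lookup ≢-sym xs! i≢j)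

-- Pigeonhole: if `y` were missed, punching it out of the codomain would leave an injection into a
-- set with fewer than `k` elements.
injective⇒surjective : {f : Fin k → Fin l} → Injective _≡_ _≡_ f → l ≤ k →
                       ∀ y → ∃[ x ] f x ≡ y
injective⇒surjective {l = suc l} {f} f-inj l<k y with any? (λ x → f x ≟ y)
... | yes hit  = hit
... | no  miss = contradiction (≤-trans l<k k≤l) 1+n≰n
  where
  y≢f : ∀ x → y ≢ f x
  y≢f x y≡fx = miss (x , sym y≡fx)
  k≤l = injective⇒≤ {f = λ x → punchOut (y≢f x)}
                    (λ eq → f-inj (punchOut-injective (y≢f _) (y≢f _) eq))

-- From minimum distance to 2-transitivity.

perm-injective : (φ : Permutation′ n) → Injective _≡_ _≡_ (φ ⟨$⟩ʳ_)
perm-injective φ = Injection.injective (↔⇒↣ φ)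

-- The two common values of φ and ψ are fixed points of φψ⁻¹.
agree-twice⇒close : (φ ψ : Permutation′ n) {x y : Fin n} → x ≢ y →
                    φ ⟨$⟩ʳ x ≡ ψ ⟨$⟩ʳ x → φ ⟨$⟩ʳ y ≡ ψ ⟨$⟩ʳ y → 2 + dH φ ψ ≤ n
agree-twice⇒close {n} φ ψ {x} {y} x≢y φx≡ψx φy≡ψy = unique-length
  ((ψx≢ψy ∷ All.map (fixed≢moved φx≡ψx) moved-all) ∷
   All.map (fixed≢moved φy≡ψy) moved-all ∷
   List.filter⁺ moved? (List.allFin⁺ n))
  where
  χ = flip ψ ∘ₚ φ
  moved? = λ z → ¬? ((χ ⟨$⟩ʳ z) ≟ z)
  moved-all = all-filter moved? (allFin n)
  ψx≢ψy = x≢y ∘ perm-injective ψ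
  fixed≢moved : ∀ {w z} → φ ⟨$⟩ʳ w ≡ ψ ⟨$⟩ʳ w → χ ⟨$⟩ʳ z ≢ z → ψ ⟨$⟩ʳ w ≢ z
  fixed≢moved φw≡ψw moved refl =
    moved (trans (cong (φ ⟨$⟩ʳ_) (inverseˡ ψ)) φw≡ψw)

-- Phrased with indices, so that the conclusion is an equality in `Fin N` rather than a pointwise
-- equality of permutations.
AgreeAtMostOnce : (Fin N → Permutation′ n) → Set
AgreeAtMostOnce F = ∀ {i j x y} → x ≢ y →
  F i ⟨$⟩ʳ x ≡ F j ⟨$⟩ʳ x → F i ⟨$⟩ʳ y ≡ F j ⟨$⟩ʳ y → i ≡ j

minDistance⇒agreeAtMostOnce : (Γ : List (Permutation′ (suc n))) → Unique Γ →
                              MinDistance≥ n Γ → AgreeAtMostOnce (lookup Γ)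
minDistance⇒agreeAtMostOnce Γ Γ! far {i} {j} x≢y eqx eqy with i ≟ j
... | yes i≡j = i≡j
... | no  i≢j = contradiction
  (≤-trans (agree-twice⇒close (lookup Γ i) (lookup Γ j) x≢y eqx eqy)
           (s≤s (far (lookup Γ i) (lookup Γ j)
                     (Setoid.∈-lookup (Sym _) Γ i) (Setoid.∈-lookup (Sym _) Γ j)
                     (AllPairs-lookup (λ φ≉ψ ψ≈φ → φ≉ψ (sym ∘ ψ≈φ)) Γ! i≢j))))
  1+n≰n

-- `punchOut` renumbers the second symbol among those other than the first, so the ordered pairs of
-- distinct symbols are coded by exactly `suc m * m` numbers. By `once` the code is injective in
-- `i`, hence it takes every value.
large⇒2-transitive : (F : Fin N → Permutation′ (suc m)) → AgreeAtMostOnce F →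
                     suc m * m ≤ N → ∀ {x y u v} → x ≢ y → u ≢ v →
                     ∃[ i ] F i ⟨$⟩ʳ x ≡ u × F i ⟨$⟩ʳ y ≡ v
large⇒2-transitive {m = m} F once large {x} {y} {u} {v} x≢y u≢v =
  let i , eq = injective⇒surjective code-injective large (combine u (punchOut u≢v))
  in  i , decode (Fx≢Fy i) u≢v eq
  where
  Fx≢Fy : ∀ i → F i ⟨$⟩ʳ x ≢ F i ⟨$⟩ʳ y
  Fx≢Fy i = x≢y ∘ perm-injective (F i)
  code : Fin _ → Fin (suc m * m)
  code i = combine (F i ⟨$⟩ʳ x) (punchOut (Fx≢Fy i))
  decode : {s t u v : Fin (suc m)} (s≢t : s ≢ t) (u≢v : u ≢ v) →
           combine s (punchOut s≢t) ≡ combine u (punchOut u≢v) → s ≡ u × t ≡ v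
  decode {s} {_} {u} s≢t u≢v eq
    with refl , eq′ ← combine-injective s (punchOut s≢t) u (punchOut u≢v) eq
    = refl , punchOut-injective s≢t u≢v eq′
  code-injective : Injective _≡_ _≡_ code
  code-injective {i} {j} eq with eqx , eqy ← decode (Fx≢Fy i) (Fx≢Fy j) eq =
    once x≢y eqx eqy

-- Backtracking search over words.

arrangements : ∀ n k → List (Vec (Fin n) k)
arrangements n zero    = [] ∷ []
-- Filtering at every length extends only words without repetition, so the list of all words is
-- never formed.
arrangements n (suc k) = filter (allPairs? (λ s t → ¬? (s ≟ t)))
  (cartesianProductWith _∷_ (allFin n) (arrangements n k))

∈-arrangements : {w : Vec (Fin n) k} → Vec.Unique w → w ∈ arrangements n k
∈-arrangements []         = here refl
∈-arrangements (s≢ ∷ w!) =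
  ∈-filter⁺ (allPairs? _) (∈-cartesianProductWith⁺ _∷_ (∈-allFin _) (∈-arrangements w!)) (s≢ ∷ w!)

disjoint? : (u v : Vec (Fin n) k) → Dec (Pointwise _≢_ u v)
disjoint? = decidable (λ s t → ¬? (s ≟ t))

compatible : Vec (Fin n) k → Vec (Fin n) k → Bool
compatible []      []      = true
compatible (s ∷ u) (t ∷ v) = if does (s ≟ t) then does (disjoint? u v) else compatible u v

compatible⁺ : (u v : Vec (Fin n) k) →
              (∀ {x y} → x ≢ y → u ‼ x ≡ v ‼ x → u ‼ y ≢ v ‼ y) → T (compatible u v)
compatible⁺ []      []      once = _
compatible⁺ (s ∷ u) (t ∷ v) once with s ≟ t
... | no  _   = compatible⁺ u v (λ x≢y → once (x≢y ∘ suc-injective))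
... | yes s≡t with disjoint? u v
...   | yes _ = _
...   | no ¬d = ¬d (extensional⇒inductive (ext λ x → once {0F} {suc x} (λ ()) s≡t))

BeginsWith : Fin n × Fin n → Vec (Fin n) (2 + k) → Set
BeginsWith (y , v) w = w ‼ 0F ≡ y × w ‼ 1F ≡ v

beginsWith? : (p : Fin n × Fin n) (w : Vec (Fin n) (2 + k)) → Dec (BeginsWith p w)
beginsWith? (y , v) w = (w ‼ 0F) ≟ y ×-dec (w ‼ 1F) ≟ v

prefix-unique : ∀ {p q} {w : Vec (Fin n) (2 + k)} → BeginsWith p w → BeginsWith q w → p ≡ q
prefix-unique (refl , refl) (refl , refl) = refl

-- A dead end is a prefix with no candidate left, where `all` over the empty list gives `true`. When
-- no prefix is left, a complete choice has been found, hence `false`.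
unsolvable : List (Fin n × Fin n) → List (Vec (Fin n) (2 + k)) → Bool
unsolvable []       ws = false
unsolvable (p ∷ ps) ws =
  all (λ w → unsolvable ps (filter (T? ∘ compatible w) ws)) (filter (beginsWith? p) ws)

-- The family `W` is itself a branch that never gets stuck: after `W i` is chosen for `p`, the word
-- for any later prefix has another index, so it is compatible with `W i` and survives the filter.
unsolvable-sound : (W : Fin N → Vec (Fin n) (2 + k)) →
  (∀ {i j} → i ≢ j → T (compatible (W i) (W j))) →
  ∀ ps ws → List.Unique ps → All (λ p → ∃[ i ] BeginsWith p (W i) × W i ∈ ws) ps →
  unsolvable ps ws ≢ true
unsolvable-sound W compat (p ∷ ps) ws (p≢ ∷ ps!) ((i , begins , Wi∈ws) ∷ choices) fails =
  unsolvable-sound W compat ps _ ps! (All.zipWith restrict (p≢ , choices)) (Equivalence.to T-≡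
    (All.lookup (all⁺ _ _ (Equivalence.from T-≡ fails)) (∈-filter⁺ (beginsWith? p) Wi∈ws begins)))
  where
  restrict : ∀ {q} → p ≢ q × (∃[ j ] BeginsWith q (W j) × W j ∈ ws) →
             ∃[ j ] BeginsWith q (W j) × W j ∈ filter (T? ∘ compatible (W i)) ws
  restrict (p≢q , j , begins′ , Wj∈ws) =
    j , begins′ , ∈-filter⁺ (T? ∘ compatible (W i)) Wj∈ws (compat i≢j)
    where
    i≢j : i ≢ j
    i≢j refl = p≢q (prefix-unique {w = W i} begins begins′)

-- The search on six symbols.

NonIdentityPrefix : Fin 6 × Fin 6 → Set
NonIdentityPrefix (y , v) = y ≢ v × (0F , 1F) ≢ (y , v)

prefix? : ∀ p → Dec (NonIdentityPrefix p)
prefix? (y , v) = ¬? (y ≟ v) ×-dec ¬? (≡-dec _≟_ _≟_ (0F , 1F) (y , v))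

-- The identity word already serves the pair of `0F` and `1F`, and its choice is built into
-- `candidates`; the other 29 pairs remain.
prefixes : List (Fin 6 × Fin 6)
prefixes = filter prefix? (cartesianProduct (allFin 6) (allFin 6))

identity : Vec (Fin 6) 6
identity = tabulate (λ x → x)

candidates : List (Vec (Fin 6) 6)
candidates = filter (T? ∘ compatible identity) (arrangements 6 6)

unsolvable-prefixes : unsolvable prefixes candidates ≡ true
-- The type checker runs the whole search here.
unsolvable-prefixes = refl

module _ (F : Fin N → Permutation′ 6) (once : AgreeAtMostOnce F) (large : 30 ≤ N)
         (o : Fin N) (Fo≈id : ∀ x → F o ⟨$⟩ʳ x ≡ x) where

  private
    W : Fin N → Vec (Fin 6) 6
    W i = tabulate (F i ⟨$⟩ʳ_)

    W-lookup : ∀ i x → W i ‼ x ≡ F i ⟨$⟩ʳ x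
    W-lookup i = lookup∘tabulate (F i ⟨$⟩ʳ_)

    compat : ∀ {i j} → i ≢ j → T (compatible (W i) (W j))
    compat {i} {j} i≢j = compatible⁺ (W i) (W j) λ x≢y eqx eqy →
      i≢j (once x≢y (agree eqx) (agree eqy))
      where
      agree : ∀ {x} → W i ‼ x ≡ W j ‼ x → F i ⟨$⟩ʳ x ≡ F j ⟨$⟩ʳ x
      agree {x} eq = trans (sym (W-lookup i x)) (trans eq (W-lookup j x))

    choose : ∀ {p} → NonIdentityPrefix p → ∃[ i ] BeginsWith p (W i) × W i ∈ candidates
    choose {y , v} (y≢v , 01≢yv)
      with i , Fi0≡y , Fi1≡v ← large⇒2-transitive F once large {0F} {1F} (λ ()) y≢v
      = i , (Fi0≡y , Fi1≡v) ,
        ∈-filter⁺ (T? ∘ compatible identity) (∈-arrangements (Vec.tabulate⁺ (perm-injective (F i))))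
          -- `W o` is the identity word, so compatibility with `W o` puts `W i` among the
          -- candidates.
          (subst (λ w → T (compatible w (W i))) (tabulate-cong Fo≈id) (compat o≢i))
      where
      o≢i : o ≢ i
      o≢i refl = 01≢yv (cong₂ _,_ (trans (sym (Fo≈id 0F)) Fi0≡y) (trans (sym (Fo≈id 1F)) Fi1≡v))

  identity∉large : ⊥
  identity∉large = unsolvable-sound W compat prefixes candidates
    (List.filter⁺ prefix? (List.cartesianProduct⁺ (List.allFin⁺ 6) (List.allFin⁺ 6)))
    (All.map choose (all-filter prefix? (cartesianProduct (allFin 6) (allFin 6))))
    unsolvable-prefixes

-- Multiplying every `F i` on the right by the inverse of `F 0F` only relabels positions, so
-- agreements are preserved, and the member at `0F` becomes the identity.
agreeAtMostOnce⇒small : (F : Fin N → Permutation′ 6) → AgreeAtMostOnce F → N < 30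
agreeAtMostOnce⇒small {zero}  F once = z<s
agreeAtMostOnce⇒small {suc N} F once = ≰⇒> λ large →
  identity∉large (λ i → flip (F 0F) ∘ₚ F i)
    (λ x≢y → once (x≢y ∘ perm-injective (flip (F 0F)))) large 0F (λ _ → inverseʳ (F 0F))

mainTheorem4 : ((m : ℕ) → M[ 6 , 5 ]≡ m → m < 30) ×
    ((Γ : List (Permutation′ 6)) → Unique Γ → MinDistance≥ 5 Γ → length Γ < 30)
mainTheorem4 = (λ { m ((Γ , Γ! , far , refl) , _) → bound Γ Γ! far }) , bound
  where
  bound : (Γ : List (Permutation′ 6)) → Unique Γ → MinDistance≥ 5 Γ → length Γ < 30
  bound Γ Γ! far = agreeAtMostOnce⇒small (lookup Γ) (minDistance⇒agreeAtMostOnce Γ Γ! far)
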